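{- Let $m\equiv 1\pmod 4$ and let $M$ be a maximum induced matching of the grid $G_{3,m}$. Suppose that for some $j$ with $1\le j$ and $j+8\le m$, both the edge joining $u_1v_j$ and $u_2v_j$ and the edge joining $u_1v_{j+8}$ and $u_2v_{j+8}$ belong to $M$. Then: (a) at least four of the vertices $u_1v_{j+1},u_1v_{j+2},\dots,u_1v_{j+7}$ are saturated by $M$; (b) at most one of the vertices $u_2v_{j+1},u_2v_{j+2},\dots,u_2v_{j+7}$ is saturated by $M$; (c) at most five of the vertices $u_3v_{j},u_3v_{j+1},\dots,u_3v_{j+8}$ are saturated by $M$.
   Context: For integers $n,m\geq 2$, the grid $G_{n,m}$ is the Cartesian product of the path $P_n=u_1u_2\cdots u_n$ and the path $P_m=v_1v_2\cdots v_m$; its vertices are written $u_iv_j$ ($1\le i\le n$, $1\le j\le m$), and $u_iv_j$, $u_kv_l$ are adjacent iff either $i=k$ and $|j-l|=1$, or $j=l$ and $|i-k|=1$. An induced matching of a graph $G$ is a set $M$ of pairwise vertex-disjoint edges such that no edge of $G$ joins endpoints of two distinct edges of $M$; a maximum induced matching is one of largest possible size. A vertex is saturated by $M$ if it is an endpoint of an edge of $M$. -}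

module Defs where

open import Data.Nat using (ℕ; suc; _+_; _≤_)
open import Data.Nat.Properties using (_≟_)
open import Data.Product using (_×_; _,_; proj₁; proj₂; Σ; ∃)
open import Data.Product.Properties using (≡-dec)
open import Data.Sum using (_⊎_)
open import Data.Fin using (Fin)
open import Data.List using (List; length; lookup; filter; map; upTo)
open import Data.List.Membership.Propositional using (_∈_)
open import Data.List.Relation.Unary.Any using (Any; any?)
open import Data.Sum.Properties using () 
open import Relation.Nullary using (¬_; Dec)
open import Relation.Nullary.Decidable using (_⊎-dec_)
open import Relation.Binary.PropositionalEquality using (_≡_)

-- Vertex u_i v_j is the pair (i , j), 1-based as in the paper.
Vertex : Set
Vertex = ℕ × ℕ

InGrid : ℕ → ℕ → Vertex → Set
InGrid n m (i , j) = (1 ≤ i × i ≤ n) × (1 ≤ j × j ≤ m)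

Adj : ℕ → ℕ → Vertex → Vertex → Set
Adj n m x@(i , j) y@(k , l) =
  InGrid n m x × InGrid n m y ×
  ((i ≡ k × (l ≡ suc j ⊎ j ≡ suc l)) ⊎ (j ≡ l × (k ≡ suc i ⊎ i ≡ suc k)))

-- An edge is given by its two endpoints (orientation irrelevant).
Edge : Set
Edge = Vertex × Vertex

Separated : ℕ → ℕ → Edge → Edge → Set
Separated n m (a , b) (c , d) =
  (x : Vertex) → (x ≡ a ⊎ x ≡ b) →
  (y : Vertex) → (y ≡ c ⊎ y ≡ d) →
  ¬ (x ≡ y) × ¬ Adj n m x y

-- An induced matching of G_{n,m}, given as a list of edges; distinct positions
-- of the list are separated (so in particular no edge is listed twice).
IsInducedMatching : ℕ → ℕ → List Edge → Set
IsInducedMatching n m M =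
  ((e : Edge) → e ∈ M → Adj n m (proj₁ e) (proj₂ e)) ×
  ((p q : Fin (length M)) → ¬ p ≡ q → Separated n m (lookup M p) (lookup M q))

IsMaximumInducedMatching : ℕ → ℕ → List Edge → Set
IsMaximumInducedMatching n m M =
  IsInducedMatching n m M ×
  ((M' : List Edge) → IsInducedMatching n m M' → length M' ≤ length M)

EdgeIn : Vertex → Vertex → List Edge → Set
EdgeIn a b M = (a , b) ∈ M ⊎ (b , a) ∈ M

Saturated : List Edge → Vertex → Set
Saturated M v = Any (λ e → v ≡ proj₁ e ⊎ v ≡ proj₂ e) M

_≟V_ : (x y : Vertex) → Dec (x ≡ y)
_≟V_ = ≡-dec _≟_ _≟_

saturated? : (M : List Edge) → (v : Vertex) → Dec (Saturated M v)
saturated? M v = any? (λ e → (v ≟V proj₁ e) ⊎-dec (v ≟V proj₂ e)) M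

countSaturated : List Edge → List Vertex → ℕ
countSaturated M vs = length (filter (saturated? M) vs)

rowSegment : ℕ → ℕ → ℕ → List Vertex
rowSegment i s len = map (λ k → (i , s + k)) (upTo len)

{-# OPTIONS --safe #-}
module Submission where

-- Record a matching by the saturated rows of each column: three consecutive columns obey the
-- local rule that a saturated vertex has exactly one saturated neighbour. A potential on pairs
-- of neighbouring columns shows that s columns to the left of a vertical edge u₁vⱼ – u₂vⱼ, or to
-- the right of one, contain at most 3s/2 saturated vertices. For m = 4k + 1 an explicit matching
-- has 3k + 1 edges, so a maximum one saturates at least (3m + 1)/2 vertices, and hence at least
-- 14 in the nine columns j, …, j + 8. A search through all sequences of nine columns that obey
-- the local rule shows that 14 can only be reached with the asserted row counts.

open import Defs
open import Data.Bool using (Bool; true; false; _∧_; not; if_then_else_; T)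
open import Data.Bool.Properties using (T-∧; T-≡)
open import Data.Fin using (Fin; zero; suc)
open import Data.Fin.Properties using (injective⇒≤) renaming (_≟_ to _≟F_)
open import Data.List using (List; []; _∷_; length; lookup; filter; map; concatMap; applyUpTo)
open import Data.List.Properties using (length-map; tabulate-lookup; map-upTo)
open import Data.List.Membership.Propositional using (_∈_)
open import Data.List.Membership.Propositional.Properties using (∈-lookup; ∈-filter⁺; ∈-concatMap⁻)
open import Data.List.Membership.Setoid.Properties using (index-injective)
open import Data.List.Relation.Unary.All as All using (All; []; _∷_)
import Data.List.Relation.Unary.All.Properties as All
open import Data.List.Relation.Unary.AllPairs as AllPairs using (AllPairs; []; _∷_)
import Data.List.Relation.Unary.AllPairs.Properties as AllPairs
open import Data.List.Relation.Unary.Any as Any using (here; there)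
open import Data.List.Relation.Unary.Any.Properties using (lookup-index)
open import Data.List.Relation.Unary.Unique.Propositional using (Unique)
open import Data.Nat using (ℕ; zero; suc; _+_; _*_; _∸_; _≤_; _<_; _≤ᵇ_; _≡ᵇ_; _%_; _/_; ∣_-_∣; z≤n; s≤s)
open import Data.Nat.DivMod using (m≡m%n+[m/n]*n)
open import Data.Nat.Properties
open import Data.Nat.Tactic.RingSolver using (solve-∀)
open import Data.Product using (_×_; _,_; proj₁; proj₂; ∃-syntax)
open import Data.Sum using (_⊎_; inj₁; inj₂)
open import Data.Unit using (tt)
open import Function using (_∘_)
open import Function.Bundles using (Equivalence)
open import Relation.Binary.PropositionalEquality
open import Relation.Nullary using (¬_; Dec; yes; no; does; contradiction)
open import Relation.Nullary.Decidable using (dec-true; dec-false)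

-- Pigeonhole and pairwise relations on lists; sums over intervals of columns.

lookup-injective : ∀ {A : Set} {xs : List A} → Unique xs → ∀ i j → lookup xs i ≡ lookup xs j → i ≡ j
lookup-injective (_  ∷ _)  zero    zero    _  = refl
lookup-injective (x∉ ∷ _)  zero    (suc j) eq = contradiction eq (All.lookup x∉ (∈-lookup j))
lookup-injective (x∉ ∷ _)  (suc i) zero    eq = contradiction (sym eq) (All.lookup x∉ (∈-lookup i))
lookup-injective (_  ∷ u)  (suc i) (suc j) eq = cong suc (lookup-injective u i j eq)

-- Pigeonhole: each position of `xs` goes to the position in `ys` that its membership proof points
-- at. Equal images carry equal elements, so uniqueness makes the map injective.
unique-⊆⇒length≤ : ∀ {A : Set} {xs ys : List A} → Unique xs → (∀ {x} → x ∈ xs → x ∈ ys) → length xs ≤ length ys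
unique-⊆⇒length≤ u sub = injective⇒≤ {f = λ i → Any.index (sub (∈-lookup i))} λ {i} {j} eq →
  lookup-injective u i j (index-injective (setoid _) (sub (∈-lookup i)) (sub (∈-lookup j)) eq)

-- `AllPairs` relates an earlier element to a later one only; symmetry of `R` supplies the pairs of
-- positions in the opposite order.
AllPairs-lookup : ∀ {A : Set} {R : A → A → Set} → (∀ {x y} → R x y → R y x) →
  ∀ {xs} → AllPairs R xs → ∀ p q → ¬ p ≡ q → R (lookup xs p) (lookup xs q)
AllPairs-lookup s (_  ∷ _)   zero    zero    p≢q = contradiction refl p≢q
AllPairs-lookup s (rx ∷ _)   zero    (suc q) _   = All.lookup rx (∈-lookup q)
AllPairs-lookup s (rx ∷ _)   (suc p) zero    _   = s (All.lookup rx (∈-lookup p))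
AllPairs-lookup s (_  ∷ rxs) (suc p) (suc q) p≢q = AllPairs-lookup s rxs p q (p≢q ∘ cong suc)

∑ : (ℕ → ℕ) → ℕ → ℕ → ℕ
∑ f s zero    = 0
∑ f s (suc k) = f s + ∑ f (suc s) k

∑-+ : ∀ f s k l → ∑ f s (k + l) ≡ ∑ f s k + ∑ f (k + s) l
∑-+ f s zero    l = refl
∑-+ f s (suc k) l = begin
  f s + ∑ f (suc s) (k + l)                      ≡⟨ cong (f s +_) (∑-+ f (suc s) k l) ⟩
  f s + (∑ f (suc s) k + ∑ f (k + suc s) l)      ≡⟨ cong (λ t → f s + (∑ f (suc s) k + ∑ f t l)) (+-suc k s) ⟩
  f s + (∑ f (suc s) k + ∑ f (suc (k + s)) l)    ≡⟨ +-assoc (f s) _ _ ⟨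
  f s + ∑ f (suc s) k + ∑ f (suc (k + s)) l      ∎
  where open ≡-Reasoning

-- Columns and the local rule

record Column : Set where
  constructor ⟨_,_,_⟩
  field
    top mid bot : Bool
open Column

wt : Bool → ℕ
wt b = if b then 1 else 0

size : Column → ℕ
size c = wt (top c) + (wt (mid c) + wt (bot c))

infixr 3 _⇒_
_⇒_ : Bool → Bool → Bool
a ⇒ b = if a then b else true

fits : Bool → Bool → Bool → Bool → Bool → Bool
fits s a b c d = s ⇒ (wt a + (wt b + (wt c + wt d)) ≡ᵇ 1)

ok : Column → Column → Column → Bool
ok p c n = fits (top c) false (mid c) (top p) (top n)
         ∧ fits (mid c) (top c) (bot c) (mid p) (mid n)
         ∧ fits (bot c) (mid c) false (bot p) (bot n)

vertical : Column → Bool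
vertical c = top c ∧ mid c

modus-ponens : ∀ {a b} → T (a ⇒ b) → T a → T b
modus-ponens {true} h _ = h

split : ∀ {a b} → T (a ∧ b) → T a × T b
split = Equivalence.to T-∧

merge : ∀ a b → T a → T b → T (a ∧ b)
merge a b ha hb = Equivalence.from (T-∧ {a} {b}) (ha , hb)

ok-intro : ∀ p c n → T (fits (top c) false (mid c) (top p) (top n)) →
  T (fits (mid c) (top c) (bot c) (mid p) (mid n)) →
  T (fits (bot c) (mid c) false (bot p) (bot n)) → T (ok p c n)
ok-intro p c n h₁ h₂ h₃ = merge (fits (top c) false (mid c) (top p) (top n)) _ h₁
  (merge (fits (mid c) (top c) (bot c) (mid p) (mid n)) _ h₂ h₃)

-- Statements about all columns, proved by evaluation.

∀Bool : (Bool → Bool) → Bool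
∀Bool f = f false ∧ f true

∀Bool-sound : ∀ f → T (∀Bool f) → ∀ b → T (f b)
∀Bool-sound f h false = proj₁ (split h)
∀Bool-sound f h true  = proj₂ (split {f false} h)

∀Column : (Column → Bool) → Bool
∀Column f = ∀Bool λ x → ∀Bool λ y → ∀Bool λ z → f ⟨ x , y , z ⟩

∀Column-sound : ∀ f → T (∀Column f) → ∀ c → T (f c)
∀Column-sound f h ⟨ x , y , z ⟩ =
  ∀Bool-sound (λ z → f ⟨ x , y , z ⟩)
    (∀Bool-sound (λ y → ∀Bool λ z → f ⟨ x , y , z ⟩)
      (∀Bool-sound (λ x → ∀Bool λ y → ∀Bool λ z → f ⟨ x , y , z ⟩) h x) y) z

∀ok : (Column → Column → Column → Bool) → Bool
∀ok f = ∀Column λ p → ∀Column λ c → ∀Column λ n → ok p c n ⇒ f p c n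

-- Proof by reflection: when all 8 * 8 * 8 triples evaluate to `true`, the type `T (∀ok f)` reduces
-- to the unit type and `tt` inhabits it.
∀ok-sound : ∀ f → T (∀ok f) → ∀ p c n → T (ok p c n) → T (f p c n)
∀ok-sound f h p c n = modus-ponens (∀Column-sound (λ n → ok p c n ⇒ f p c n)
  (∀Column-sound (λ c → ∀Column λ n → ok p c n ⇒ f p c n)
    (∀Column-sound (λ p → ∀Column λ c → ∀Column λ n → ok p c n ⇒ f p c n) h p) c) n)

-- Potentials

-- Passing column `c` must raise χ by at least the excess of `2 * size c` over 3, so 3/2 saturated
-- vertices per column is the break-even rate. Doubling and moving terms across keeps everything in
-- ℕ.
IsPotential : (Column → Column → ℕ) → Set
IsPotential χ = ∀ p c n → T (ok p c n) → χ p c + 2 * size c ≤ χ c n + 3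

isPotential? : (Column → Column → ℕ) → Bool
isPotential? χ = ∀ok λ p c n → χ p c + 2 * size c ≤ᵇ χ c n + 3

isPotential?-sound : ∀ χ → T (isPotential? χ) → IsPotential χ
isPotential?-sound χ h p c n o = ≤ᵇ⇒≤ _ _ (∀ok-sound (λ p c n → χ p c + 2 * size c ≤ᵇ χ c n + 3) h p c n o)

disjoint : Column → Column → Bool
disjoint p c = not (top p ∧ top c) ∧ not (mid p ∧ mid c) ∧ not (bot p ∧ bot c)

-- For columns c 0 = ∅, c 1, c 2, …, φ (c t) (c (t + 1)) bounds 2 * (number of saturated vertices
-- in columns 1..t) - 3 t. Its values come from longest paths in the transition graph of the local
-- rule; at transitions that cannot occur they are arbitrary.
φ : Column → Column → ℕ
φ ⟨ false , true  , false ⟩   c = wt (mid c)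
φ p@(⟨ true  , true  , false ⟩) c = wt (disjoint p c)
φ p@(⟨ false , true  , true  ⟩) c = wt (disjoint p c)
φ p@(⟨ true  , false , true  ⟩) c = suc (wt (disjoint p c))
φ _                           c = 0

-- The mirror image of φ, for walks from the right; the 2 avoids truncation, as φ ≤ 2.
φʳ : Column → Column → ℕ
φʳ p c = 2 ∸ φ c p

φ-potential : IsPotential φ
φ-potential = isPotential?-sound φ tt

-- `ok` is symmetric in its outer columns, so reversing the direction and negating turns one
-- potential into another; the check itself is again an evaluation.
φʳ-potential : IsPotential φʳ
φʳ-potential = isPotential?-sound φʳ tt

-- The ends of a vertical edge are each other's only saturated neighbour. Hence `p` is empty in rows
-- 1 and 2, where `φ` takes its default value 0.
φ-vertical : ∀ p c n → T (ok p c n) → T (vertical c) → φ p c ≤ 0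
φ-vertical p c n o v =
  ≤ᵇ⇒≤ _ _ (modus-ponens (∀ok-sound (λ p c n → vertical c ⇒ φ p c ≤ᵇ 0) tt p c n o) v)

-- The same argument on the right: `n` is empty in rows 1 and 2, so `φ n c` is 0 and `φʳ c n`
-- attains its largest value.
φʳ-vertical : ∀ p c n → T (ok p c n) → T (vertical c) → 2 ≤ φʳ c n
φʳ-vertical p c n o v =
  ≤ᵇ⇒≤ _ _ (modus-ponens (∀ok-sound (λ p c n → vertical c ⇒ 2 ≤ᵇ φʳ c n) tt p c n o) v)

-- Exhaustive search through windows of nine columns.

Tally : Set
Tally = ℕ → ℕ → ℕ → ℕ → Column → Bool

-- Runs through all continuations of the columns p, c by k columns. The tally receives the
-- total and the three row counts of the k columns from c on, and the last of these columns.
everyWalk : ℕ → Tally → Column → Column → Bool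
everyWalk zero    P p c = P 0 0 0 0 p
everyWalk (suc k) P p c = ∀Column λ n → ok p c n ⇒
  everyWalk k (λ w x y z → P (size c + w) (wt (top c) + x) (wt (mid c) + y) (wt (bot c) + z)) c n

-- The tallies include both end columns, each of which adds 1 to rows 1 and 2 when it is vertical.
-- The bounds 4 and 1 for the seven inner columns therefore become 6 and 3, while the bound 5 for
-- row 3 concerns all nine columns anyway.
windowTally : Tally
windowTally w x y z d = vertical d ⇒ 14 ≤ᵇ w ⇒ (6 ≤ᵇ x) ∧ (y ≤ᵇ 3) ∧ (z ≤ᵇ 5)

abstract
  -- Here `c` is the first column of the window and `p` the one before it. Nine steps also choose a
  -- column after the window, so the local rule is imposed on both end columns too. `abstract` keeps
  -- the proof term opaque to its users.
  everyWindow : ∀ p c → T (vertical c) → T (everyWalk 9 windowTally p c)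
  everyWindow p c = modus-ponens (∀Column-sound (λ c → vertical c ⇒ everyWalk 9 windowTally p c)
    (∀Column-sound (λ p → ∀Column λ c → vertical c ⇒ everyWalk 9 windowTally p c) tt p) c)

-- Bounds along an infinite sequence of columns that obeys the local rule.

module Walk (c : ℕ → Column) (c-ok : ∀ t → T (ok (c t) (c (1 + t)) (c (2 + t)))) where

  -- Adding the potential inequality over columns `s + 1` to `s + k` cancels all intermediate values
  -- of χ.
  telescope : ∀ {χ} → IsPotential χ → ∀ s k →
    2 * ∑ (size ∘ c) (suc s) k + χ (c s) (c (suc s)) ≤ 3 * k + χ (c (k + s)) (c (suc (k + s)))
  telescope         pot s zero    = ≤-refl
  telescope {χ = χ} pot s (suc k) = begin
    2 * (x + S) + χ (c s) (c (suc s))                            ≡⟨ lhs x S (χ (c s) (c (suc s))) ⟩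
    2 * S + (χ (c s) (c (suc s)) + 2 * x)                        ≤⟨ +-monoʳ-≤ (2 * S) (pot (c s) (c (1 + s)) (c (2 + s)) (c-ok s)) ⟩
    2 * S + (χ (c (1 + s)) (c (2 + s)) + 3)                      ≡⟨ +-assoc (2 * S) _ 3 ⟨
    2 * S + χ (c (1 + s)) (c (2 + s)) + 3                        ≤⟨ +-monoˡ-≤ 3 (telescope {χ} pot (suc s) k) ⟩
    3 * k + χ (c (k + suc s)) (c (suc (k + suc s))) + 3          ≡⟨ cong (λ t → 3 * k + χ (c t) (c (suc t)) + 3) (+-suc k s) ⟩
    3 * k + χ (c (suc k + s)) (c (suc (suc k + s))) + 3          ≡⟨ rhs k (χ (c (suc k + s)) (c (suc (suc k + s)))) ⟩
    3 * suc k + χ (c (suc k + s)) (c (suc (suc k + s)))          ∎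
    where
    open ≤-Reasoning
    x S : ℕ
    x = size (c (suc s))
    S = ∑ (size ∘ c) (suc (suc s)) k
    lhs : ∀ x S a → 2 * (x + S) + a ≡ 2 * S + (a + 2 * x)
    lhs = solve-∀
    rhs : ∀ k a → 3 * k + a + 3 ≡ 3 * suc k + a
    rhs = solve-∀

  -- Each universally quantified next column is instantiated with the actual one, which `c-ok`
  -- admits. The induction is over all tallies, because the contribution of a column just passed is
  -- stored inside the tally.
  everyWalk-sound : ∀ k P t → T (everyWalk k P (c t) (c (suc t))) →
    T (P (∑ (size ∘ c) (suc t) k) (∑ (wt ∘ top ∘ c) (suc t) k)
         (∑ (wt ∘ mid ∘ c) (suc t) k) (∑ (wt ∘ bot ∘ c) (suc t) k) (c (k + t)))
  everyWalk-sound zero    P t h = h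
  everyWalk-sound (suc k) P t h = subst (λ u → T (P (∑ (size ∘ c) (suc t) (suc k)) (∑ (wt ∘ top ∘ c) (suc t) (suc k))
                     (∑ (wt ∘ mid ∘ c) (suc t) (suc k)) (∑ (wt ∘ bot ∘ c) (suc t) (suc k)) (c u))) (+-suc k t)
    (everyWalk-sound k P' (suc t)
      (modus-ponens (∀Column-sound (λ n → ok (c t) (c (suc t)) n ⇒ everyWalk k P' (c (suc t)) n) h (c (2 + t)))
        (c-ok t)))
    where
    P' : Tally
    P' w x y z = P (size (c (suc t)) + w) (wt (top (c (suc t))) + x)
                   (wt (mid (c (suc t))) + y) (wt (bot (c (suc t))) + z)

  -- Of the `a + 9 + r` columns, the left part contributes at most `3 * a` to the doubled count and
  -- the right part at most `3 * r`. What is left for the window is `3 * 9 + 1 = 28`, twice 14.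
  window-size : ∀ a r → 3 * (a + (9 + r)) + 1 ≤ 2 * ∑ (size ∘ c) 1 (a + (9 + r)) →
    T (vertical (c (1 + a))) → T (vertical (c (9 + a))) → 14 ≤ ∑ (size ∘ c) (1 + a) 9
  window-size a r large v₁ v₉ = *-cancelˡ-≤ 2 (+-cancelʳ-≤ (3 * a + 3 * r) 28 (2 * B) (begin
    28 + (3 * a + 3 * r)                        ≡⟨ lhs a r ⟩
    3 * (a + (9 + r)) + 1                       ≤⟨ large ⟩
    2 * ∑ (size ∘ c) 1 (a + (9 + r))            ≡⟨ cong (2 *_) parts ⟩
    2 * (A + (B + C))                           ≡⟨ rhs A B C ⟩
    2 * B + (2 * A + 2 * C)                     ≤⟨ +-monoʳ-≤ (2 * B) (+-mono-≤ left right) ⟩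
    2 * B + (3 * a + 3 * r)                     ∎))
    where
    open ≤-Reasoning
    A B C : ℕ
    A = ∑ (size ∘ c) 1 a
    B = ∑ (size ∘ c) (1 + a) 9
    C = ∑ (size ∘ c) (10 + a) r

    parts : ∑ (size ∘ c) 1 (a + (9 + r)) ≡ A + (B + C)
    parts = trans (∑-+ (size ∘ c) 1 a (9 + r)) (cong (A +_)
      (trans (cong (λ s → ∑ (size ∘ c) s (9 + r)) (+-comm a 1)) (∑-+ (size ∘ c) (1 + a) 9 r)))

    left : 2 * A ≤ 3 * a
    left = begin
      2 * A                                       ≤⟨ m≤m+n (2 * A) _ ⟩
      2 * A + φ (c 0) (c 1)                       ≤⟨ telescope {φ} φ-potential 0 a ⟩
      3 * a + φ (c (a + 0)) (c (1 + (a + 0)))     ≡⟨ cong (λ t → 3 * a + φ (c t) (c (1 + t))) (+-identityʳ a) ⟩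
      3 * a + φ (c a) (c (1 + a))                 ≤⟨ +-monoʳ-≤ (3 * a) (φ-vertical (c a) (c (1 + a)) (c (2 + a)) (c-ok a) v₁) ⟩
      3 * a + 0                                   ≡⟨ +-identityʳ (3 * a) ⟩
      3 * a                                       ∎

    right : 2 * C ≤ 3 * r
    -- The value 2 of `φʳ` beside the vertical column cancels the at most 2 that `φʳ` can have at
    -- the far right.
    right = +-cancelʳ-≤ 2 (2 * C) (3 * r) (begin
      2 * C + 2                                                   ≤⟨ +-monoʳ-≤ (2 * C) (φʳ-vertical (c (8 + a)) (c (9 + a)) (c (10 + a)) (c-ok (8 + a)) v₉) ⟩
      2 * C + φʳ (c (9 + a)) (c (10 + a))                         ≤⟨ telescope {φʳ} φʳ-potential (9 + a) r ⟩
      3 * r + φʳ (c (r + (9 + a))) (c (suc (r + (9 + a))))        ≤⟨ +-monoʳ-≤ (3 * r) (m∸n≤m 2 (φ (c (suc (r + (9 + a)))) (c (r + (9 + a))))) ⟩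
      3 * r + 2                                                   ∎)

    lhs : ∀ a r → 28 + (3 * a + 3 * r) ≡ 3 * (a + (9 + r)) + 1
    lhs = solve-∀
    rhs : ∀ A B C → 2 * (A + (B + C)) ≡ 2 * B + (2 * A + 2 * C)
    rhs = solve-∀

  window-rows : ∀ a → T (vertical (c (1 + a))) → T (vertical (c (9 + a))) → 14 ≤ ∑ (size ∘ c) (1 + a) 9 →
    6 ≤ ∑ (wt ∘ top ∘ c) (1 + a) 9 × ∑ (wt ∘ mid ∘ c) (1 + a) 9 ≤ 3 × ∑ (wt ∘ bot ∘ c) (1 + a) 9 ≤ 5
  window-rows a v₁ v₉ large =
    ≤ᵇ⇒≤ 6 _ (proj₁ rows) , ≤ᵇ⇒≤ _ 3 (proj₁ (split {mids} (proj₂ rows))) , ≤ᵇ⇒≤ _ 5 (proj₂ (split {mids} (proj₂ rows)))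
    where
    tops mids bots : Bool
    tops = 6 ≤ᵇ ∑ (wt ∘ top ∘ c) (1 + a) 9
    mids = ∑ (wt ∘ mid ∘ c) (1 + a) 9 ≤ᵇ 3
    bots = ∑ (wt ∘ bot ∘ c) (1 + a) 9 ≤ᵇ 5

    rows : T tops × T (mids ∧ bots)
    rows = split {tops} (modus-ponens {14 ≤ᵇ ∑ (size ∘ c) (1 + a) 9}
      (modus-ponens {vertical (c (9 + a))}
        (everyWalk-sound 9 windowTally a (everyWindow (c a) (c (suc a)) v₁)) v₉) (≤⇒≤ᵇ large))

-- Saturation in an induced matching

bit : List Edge → ℕ → ℕ → Bool
bit M i t = does (saturated? M (i , t))

column : List Edge → ℕ → Column
column M t = ⟨ bit M 1 t , bit M 2 t , bit M 3 t ⟩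

Endpoint : Edge → Vertex → Set
Endpoint e v = v ≡ proj₁ e ⊎ v ≡ proj₂ e

Adj-irrefl : ∀ {n m v} → ¬ Adj n m v v
Adj-irrefl (_ , _ , inj₁ (_ , inj₁ ()))
Adj-irrefl (_ , _ , inj₁ (_ , inj₂ ()))
Adj-irrefl (_ , _ , inj₂ (_ , inj₁ ()))
Adj-irrefl (_ , _ , inj₂ (_ , inj₂ ()))

Adj-sym : ∀ {n m x y} → Adj n m x y → Adj n m y x
Adj-sym (gx , gy , inj₁ (refl , inj₁ refl)) = gy , gx , inj₁ (refl , inj₂ refl)
Adj-sym (gx , gy , inj₁ (refl , inj₂ refl)) = gy , gx , inj₁ (refl , inj₁ refl)
Adj-sym (gx , gy , inj₂ (refl , inj₁ refl)) = gy , gx , inj₂ (refl , inj₂ refl)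
Adj-sym (gx , gy , inj₂ (refl , inj₂ refl)) = gy , gx , inj₂ (refl , inj₁ refl)

Separated-sym : ∀ {n m e f} → Separated n m e f → Separated n m f e
Separated-sym sep y y∈f x x∈e =
  (λ y≡x → proj₁ (sep x x∈e y y∈f) (sym y≡x)) , (λ a → proj₂ (sep x x∈e y y∈f) (Adj-sym a))

fits-if : ∀ {A : Set} (A? : Dec A) {b} → (A → T b) → T (does A? ⇒ b)
fits-if (yes a) f = f a
fits-if (no _)  f = tt

module _ {n m : ℕ} {M : List Edge} (im : IsInducedMatching n m M) where

  saturated-inGrid : ∀ {v} → Saturated M v → InGrid n m v
  saturated-inGrid sv with proj₁ im _ (∈-lookup (Any.index sv)) | lookup-index sv
  ... | ga , gb , _ | inj₁ v≡a = subst (InGrid n m) (sym v≡a) ga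
  ... | ga , gb , _ | inj₂ v≡b = subst (InGrid n m) (sym v≡b) gb

  unsaturated : ∀ i t → ¬ InGrid n m (i , t) → bit M i t ≡ false
  unsaturated i t out = dec-false (saturated? M (i , t)) (out ∘ saturated-inGrid)

  -- The witness is the other end of the edge at `v`. A saturated neighbour on an edge at another
  -- list position would contradict separation, so it lies on the same edge, and it is not `v`
  -- itself since adjacency is irreflexive.
  partner : ∀ {v} → Saturated M v →
    ∃[ w ] Adj n m v w × Saturated M w × (∀ x → Adj n m v x → Saturated M x → x ≡ w)
  partner {v} sv = other (lookup-index sv)
    where
    p : Fin (length M)
    p = Any.index sv

    e∈M : lookup M p ∈ M
    e∈M = ∈-lookup p

    a b : Vertex
    a = proj₁ (lookup M p)
    b = proj₂ (lookup M p)

    a~b : Adj n m a b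
    a~b = proj₁ im (lookup M p) e∈M

    saturated-by : ∀ {x} → Endpoint (lookup M p) x → Saturated M x
    saturated-by h = Any.map (λ { refl → h }) e∈M

    same-edge : ∀ x → Adj n m v x → Saturated M x → Endpoint (lookup M p) x
    same-edge x adj sx with p ≟F Any.index sx
    ... | yes eq = subst (λ q → Endpoint (lookup M q) x) (sym eq) (lookup-index sx)
    ... | no p≢q = contradiction adj
          (proj₂ (proj₂ im p (Any.index sx) p≢q v (lookup-index sv) x (lookup-index sx)))

    other : Endpoint (lookup M p) v →
      ∃[ w ] Adj n m v w × Saturated M w × (∀ x → Adj n m v x → Saturated M x → x ≡ w)
    other (inj₁ v≡a) = b , subst (λ u → Adj n m u b) (sym v≡a) a~b , saturated-by (inj₂ refl) , unique
      where
      unique : ∀ x → Adj n m v x → Saturated M x → x ≡ b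
      unique x adj sx with same-edge x adj sx
      ... | inj₁ x≡a = contradiction (subst (Adj n m v) (trans x≡a (sym v≡a)) adj) Adj-irrefl
      ... | inj₂ x≡b = x≡b
    other (inj₂ v≡b) = a , subst (λ u → Adj n m u a) (sym v≡b) (Adj-sym a~b) , saturated-by (inj₁ refl) , unique
      where
      unique : ∀ x → Adj n m v x → Saturated M x → x ≡ a
      unique x adj sx with same-edge x adj sx
      ... | inj₁ x≡a = x≡a
      ... | inj₂ x≡b = contradiction (subst (Adj n m v) (trans x≡b (sym v≡b)) adj) Adj-irrefl

  -- The partner is one of the four lattice neighbours, and its uniqueness makes the other three
  -- bits false. Neighbours outside the grid, such as those in row 0 or column 0, need no separate
  -- case: saturation implies lying in the grid.
  one-neighbour : ∀ i t → T (fits (bit M (suc i) (suc t))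
    (bit M i (suc t)) (bit M (2 + i) (suc t)) (bit M (suc i) t) (bit M (suc i) (2 + t)))
  one-neighbour i t = fits-if (saturated? M v) λ sv → count sv (partner sv)
    where
    one : Bool
    one = wt (bit M i (suc t)) + (wt (bit M (2 + i) (suc t)) + (wt (bit M (suc i) t) + wt (bit M (suc i) (2 + t)))) ≡ᵇ 1

    v up down left right : Vertex
    v     = suc i , suc t
    up    = i , suc t
    down  = 2 + i , suc t
    left  = suc i , t
    right = suc i , 2 + t

    count : Saturated M v →
      ∃[ w ] Adj n m v w × Saturated M w × (∀ x → Adj n m v x → Saturated M x → x ≡ w) →
      T one
    count sv (w , (_ , _ , adj) , sw , unique) = cases w adj sw
      (λ s → unique up    (saturated-inGrid sv , saturated-inGrid s , inj₂ (refl , inj₂ refl)) s)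
      (λ s → unique down  (saturated-inGrid sv , saturated-inGrid s , inj₂ (refl , inj₁ refl)) s)
      (λ s → unique left  (saturated-inGrid sv , saturated-inGrid s , inj₁ (refl , inj₂ refl)) s)
      (λ s → unique right (saturated-inGrid sv , saturated-inGrid s , inj₁ (refl , inj₁ refl)) s)
      where
      cases : ∀ w → (suc i ≡ proj₁ w × (proj₂ w ≡ suc (suc t) ⊎ suc t ≡ suc (proj₂ w)))
                  ⊎ (suc t ≡ proj₂ w × (proj₁ w ≡ suc (suc i) ⊎ suc i ≡ suc (proj₁ w))) →
        Saturated M w →
        (Saturated M up → up ≡ w) → (Saturated M down → down ≡ w) →
        (Saturated M left → left ≡ w) → (Saturated M right → right ≡ w) →
        T one
      cases _ (inj₁ (refl , inj₁ refl)) sw u d l r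
        rewrite dec-false (saturated? M up) (λ s → contradiction (u s) λ ())
              | dec-false (saturated? M down) (λ s → contradiction (d s) λ ())
              | dec-false (saturated? M left) (λ s → contradiction (l s) λ ())
              | dec-true (saturated? M right) sw = tt
      cases _ (inj₁ (refl , inj₂ refl)) sw u d l r
        rewrite dec-false (saturated? M up) (λ s → contradiction (u s) λ ())
              | dec-false (saturated? M down) (λ s → contradiction (d s) λ ())
              | dec-true (saturated? M left) sw
              | dec-false (saturated? M right) (λ s → contradiction (r s) λ ()) = tt
      cases _ (inj₂ (refl , inj₁ refl)) sw u d l r
        rewrite dec-false (saturated? M up) (λ s → contradiction (u s) λ ())
              | dec-true (saturated? M down) sw
              | dec-false (saturated? M left) (λ s → contradiction (l s) λ ())
              | dec-false (saturated? M right) (λ s → contradiction (r s) λ ()) = tt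
      cases _ (inj₂ (refl , inj₂ refl)) sw u d l r
        rewrite dec-true (saturated? M up) sw
              | dec-false (saturated? M down) (λ s → contradiction (d s) λ ())
              | dec-false (saturated? M left) (λ s → contradiction (l s) λ ())
              | dec-false (saturated? M right) (λ s → contradiction (r s) λ ()) = tt

module _ {m : ℕ} {M : List Edge} (im : IsInducedMatching 3 m M) where

  column-ok : ∀ t → T (ok (column M t) (column M (1 + t)) (column M (2 + t)))
  column-ok t = ok-intro (column M t) (column M (1 + t)) (column M (2 + t))
    -- `one-neighbour` reads rows 0 and 4 where `ok` has the constant `false`; both rows lie outside
    -- the grid.
    (subst (λ b → T (fits (bit M 1 (1 + t)) b (bit M 2 (1 + t)) (bit M 1 t) (bit M 1 (2 + t))))
      (unsaturated im 0 (suc t) λ { ((() , _) , _) }) (one-neighbour im 0 t))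
    (one-neighbour im 1 t)
    (subst (λ b → T (fits (bit M 3 (1 + t)) (bit M 2 (1 + t)) b (bit M 3 t) (bit M 3 (2 + t))))
      (unsaturated im 4 (suc t) λ { ((_ , s≤s (s≤s (s≤s ()))) , _) }) (one-neighbour im 2 t))

-- Counting saturated vertices by rows and by columns.

countSaturated-∷ : ∀ M i t vs → countSaturated M ((i , t) ∷ vs) ≡ wt (bit M i t) + countSaturated M vs
countSaturated-∷ M i t vs with saturated? M (i , t)
... | yes _ = refl
... | no  _ = refl

-- `applyUpTo` recurses on `f ∘ suc`, so the induction needs an arbitrary `f` known only pointwise.
countSaturated-applyUpTo : ∀ M i s k f → (∀ l → f l ≡ (i , l + s)) →
  countSaturated M (applyUpTo f k) ≡ ∑ (wt ∘ bit M i) s k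
countSaturated-applyUpTo M i s zero    f eq = refl
countSaturated-applyUpTo M i s (suc k) f eq = begin
  countSaturated M (f 0 ∷ applyUpTo (f ∘ suc) k)                ≡⟨ cong (λ v → countSaturated M (v ∷ applyUpTo (f ∘ suc) k)) (eq 0) ⟩
  countSaturated M ((i , s) ∷ applyUpTo (f ∘ suc) k)            ≡⟨ countSaturated-∷ M i s (applyUpTo (f ∘ suc) k) ⟩
  wt (bit M i s) + countSaturated M (applyUpTo (f ∘ suc) k)     ≡⟨ cong (wt (bit M i s) +_) (countSaturated-applyUpTo M i (suc s) k (f ∘ suc)
                                                                    (λ l → trans (eq (suc l)) (cong (i ,_) (sym (+-suc l s))))) ⟩
  wt (bit M i s) + ∑ (wt ∘ bit M i) (suc s) k                   ∎
  where open ≡-Reasoning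

countSaturated-rowSegment : ∀ M i s k → countSaturated M (rowSegment i s k) ≡ ∑ (wt ∘ bit M i) s k
countSaturated-rowSegment M i s k = trans (cong (countSaturated M) (map-upTo (λ l → (i , s + l)) k))
  (countSaturated-applyUpTo M i s k (λ l → (i , s + l)) (λ l → cong (i ,_) (+-comm s l)))

cells : ℕ → ℕ → List Vertex
cells s zero    = []
cells s (suc k) = (1 , s) ∷ (2 , s) ∷ (3 , s) ∷ cells (suc s) k

countSaturated-cells : ∀ M s k → countSaturated M (cells s k) ≡ ∑ (size ∘ column M) s k
countSaturated-cells M s zero    = refl
countSaturated-cells M s (suc k)
  rewrite countSaturated-∷ M 1 s ((2 , s) ∷ (3 , s) ∷ cells (suc s) k)
        | countSaturated-∷ M 2 s ((3 , s) ∷ cells (suc s) k)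
        | countSaturated-∷ M 3 s (cells (suc s) k)
        | countSaturated-cells M (suc s) k
  = assoc (wt (bit M 1 s)) (wt (bit M 2 s)) (wt (bit M 3 s)) (∑ (size ∘ column M) (suc s) k)
  where
  assoc : ∀ x y z w → x + (y + (z + w)) ≡ x + (y + z) + w
  assoc = solve-∀

∈-cells : ∀ {i j} s k → 1 ≤ i → i ≤ 3 → s ≤ j → j < s + k → (i , j) ∈ cells s k
∈-cells {i} {j} s zero    1≤i i≤3 s≤j j<s+k = contradiction (subst (j <_) (+-identityʳ s) j<s+k) (≤⇒≯ s≤j)
∈-cells {i} {j} s (suc k) 1≤i i≤3 s≤j j<s+k with m≤n⇒m<n∨m≡n s≤j
... | inj₁ s<j = there (there (there (∈-cells (suc s) k 1≤i i≤3 s<j (subst (j <_) (+-suc s k) j<s+k))))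
... | inj₂ refl = row i 1≤i i≤3
  where
  row : ∀ i → 1 ≤ i → i ≤ 3 → (i , s) ∈ cells s (suc k)
  row 1 _ _ = here refl
  row 2 _ _ = there (here refl)
  row 3 _ _ = there (there (here refl))
  row (suc (suc (suc (suc _)))) _ (s≤s (s≤s (s≤s ())))

ends : Edge → List Vertex
ends (a , b) = a ∷ b ∷ []

ends⇒Endpoint : ∀ {e v} → v ∈ ends e → Endpoint e v
ends⇒Endpoint (here refl)         = inj₁ refl
ends⇒Endpoint (there (here refl)) = inj₂ refl

Endpoint⇒ends : ∀ {e v} → Endpoint e v → v ∈ ends e
Endpoint⇒ends (inj₁ refl) = here refl
Endpoint⇒ends (inj₂ refl) = there (here refl)

length-endpoints : ∀ M → length (concatMap ends M) ≡ 2 * length M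
length-endpoints []      = refl
length-endpoints (e ∷ M) = trans (cong (2 +_) (length-endpoints M)) (sym (*-suc 2 (length M)))

module _ {n m : ℕ} {M : List Edge} (im : IsInducedMatching n m M) where

  separated-pairs : AllPairs (Separated n m) M
  separated-pairs = subst (AllPairs (Separated n m)) (tabulate-lookup M) (AllPairs.tabulate⁺ λ {p} {q} → proj₂ im p q)

  -- Within an edge by irreflexivity of adjacency, across edges by separation.
  endpoints-unique : Unique (concatMap ends M)
  endpoints-unique = AllPairs.concat⁺
    (All.map⁺ (All.tabulate λ {e} e∈M → (distinct e (proj₁ im e e∈M) ∷ []) ∷ [] ∷ []))
    (AllPairs.map⁺ (AllPairs.map apart separated-pairs))
    where
    distinct : ∀ e → Adj n m (proj₁ e) (proj₂ e) → ¬ proj₁ e ≡ proj₂ e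
    distinct (a , b) adj refl = Adj-irrefl adj

    apart : ∀ {e f} → Separated n m e f → All (λ x → All (λ y → ¬ x ≡ y) (ends f)) (ends e)
    apart sep = All.tabulate λ x∈ → All.tabulate λ y∈ → proj₁ (sep _ (ends⇒Endpoint x∈) _ (ends⇒Endpoint y∈))

-- The endpoints form a duplicate-free list of `2 * length M` saturated grid vertices, so the
-- pigeonhole lemma compares it with the saturated cells.
2*length≤size : ∀ {m M} → IsInducedMatching 3 m M → 2 * length M ≤ ∑ (size ∘ column M) 1 m
2*length≤size {m} {M} im = begin
  2 * length M                                     ≡⟨ length-endpoints M ⟨
  length (concatMap ends M)                        ≤⟨ unique-⊆⇒length≤ (endpoints-unique im) covered ⟩
  countSaturated M (cells 1 m)                     ≡⟨ countSaturated-cells M 1 m ⟩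
  ∑ (size ∘ column M) 1 m                          ∎
  where
  open ≤-Reasoning
  covered : ∀ {v} → v ∈ concatMap ends M → v ∈ filter (saturated? M) (cells 1 m)
  covered {v} v∈ with Any.map ends⇒Endpoint (∈-concatMap⁻ ends {xs = M} v∈)
  ... | sv with saturated-inGrid im sv
  ... | (1≤i , i≤3) , (1≤j , j≤m) = ∈-filter⁺ (saturated? M) (∈-cells 1 m 1≤i i≤3 1≤j (s≤s j≤m)) sv

-- A large induced matching

-- Manhattan distance at least 2. It excludes equality and adjacency at once, independently of the
-- grid size.
Far : Vertex → Vertex → Set
Far (i , j) (k , l) = 2 ≤ ∣ i - k ∣ + ∣ j - l ∣

∣n-1+n∣≡1 : ∀ n → ∣ n - suc n ∣ ≡ 1
∣n-1+n∣≡1 zero    = refl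
∣n-1+n∣≡1 (suc n) = ∣n-1+n∣≡1 n

∣1+n-n∣≡1 : ∀ n → ∣ suc n - n ∣ ≡ 1
∣1+n-n∣≡1 zero    = refl
∣1+n-n∣≡1 (suc n) = ∣1+n-n∣≡1 n

Far⇒separated : ∀ {n m} x y → Far x y → ¬ x ≡ y × ¬ Adj n m x y
Far⇒separated (i , j) (k , l) far = distinct far , nonadjacent far
  where
  distinct : 2 ≤ ∣ i - k ∣ + ∣ j - l ∣ → ¬ (i , j) ≡ (k , l)
  distinct h refl rewrite ∣n-n∣≡0 i | ∣n-n∣≡0 j with () ← h

  nonadjacent : ∀ {n m} → 2 ≤ ∣ i - k ∣ + ∣ j - l ∣ → ¬ Adj n m (i , j) (k , l)
  nonadjacent h (_ , _ , inj₁ (refl , inj₁ refl)) rewrite ∣n-n∣≡0 i | ∣n-1+n∣≡1 j with s≤s () ← h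
  nonadjacent h (_ , _ , inj₁ (refl , inj₂ refl)) rewrite ∣n-n∣≡0 i | ∣1+n-n∣≡1 l with s≤s () ← h
  nonadjacent h (_ , _ , inj₂ (refl , inj₁ refl)) rewrite ∣n-n∣≡0 j | ∣n-1+n∣≡1 i with s≤s () ← h
  nonadjacent h (_ , _ , inj₂ (refl , inj₂ refl)) rewrite ∣n-n∣≡0 j | ∣1+n-n∣≡1 k with s≤s () ← h

FarEdges : Edge → Edge → Set
FarEdges e f = All (λ x → All (Far x) (ends f)) (ends e)

FarEdges⇒Separated : ∀ {n m e f} → FarEdges e f → Separated n m e f
FarEdges⇒Separated far x x∈e y y∈f =
  Far⇒separated x y (All.lookup (All.lookup far (Endpoint⇒ends x∈e)) (Endpoint⇒ends y∈f))

shift : Vertex → Vertex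
shift (i , j) = i , 4 + j

shiftEdge : Edge → Edge
shiftEdge (a , b) = shift a , shift b

outer : Bool → ℕ
outer s = if s then 1 else 3

-- Three edges for every four columns and a final vertical edge. A block ends at `(outer s , 4)`, so
-- the next vertical edge, in column 5, must use the opposite outer row; hence the flip of `s`.
zigzag : Bool → ℕ → List Edge
zigzag s zero    = ((outer s , 1) , (2 , 1)) ∷ []
zigzag s (suc k) =
  ((outer s , 1) , (2 , 1)) ∷
  ((outer (not s) , 2) , (outer (not s) , 3)) ∷
  ((outer s , 3) , (outer s , 4)) ∷
  map shiftEdge (zigzag (not s) k)

length-zigzag : ∀ s k → length (zigzag s k) ≡ 1 + 3 * k
length-zigzag s zero    = refl
length-zigzag s (suc k)
  rewrite length-map shiftEdge (zigzag (not s) k) | length-zigzag (not s) k = arith k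
  where
  arith : ∀ k → 3 + (1 + 3 * k) ≡ 1 + 3 * suc k
  arith = solve-∀

-- The vertex (r , 0), just left of the first column, is far from (i , j).
Clear : ℕ → Vertex → Set
Clear r (i , j) = 1 ≤ j × 2 ≤ ∣ r - i ∣ + j

ClearEdge : ℕ → Edge → Set
ClearEdge r e = All (Clear r) (ends e)

2≤ : ∀ {k} → 2 ≤ 2 + k
2≤ = s≤s (s≤s z≤n)

-- Only the edge in column 1 depends on the row; everything else is at least two columns from column
-- 0. After the shift, this is the distance from the last vertex of one block to the next block.
zigzag-clear : ∀ s k → All (ClearEdge (outer (not s))) (zigzag s k)
zigzag-clear = clear
  where
  start : ∀ s → ClearEdge (outer (not s)) ((outer s , 1) , (2 , 1))
  start true  = (s≤s z≤n , 2≤) ∷ (s≤s z≤n , 2≤) ∷ []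
  start false = (s≤s z≤n , 2≤) ∷ (s≤s z≤n , 2≤) ∷ []

  beyond : ∀ r i j → Clear r (i , 2 + j)
  beyond r i j = s≤s z≤n , ≤-trans 2≤ (m≤n+m (2 + j) ∣ r - i ∣)

  clear : ∀ s k → All (ClearEdge (outer (not s))) (zigzag s k)
  clear s zero    = start s ∷ []
  clear s (suc k) = start s
    ∷ (beyond r r 0 ∷ beyond r r 1 ∷ [])
    ∷ (beyond r (outer s) 1 ∷ beyond r (outer s) 2 ∷ [])
    ∷ All.map⁺ (All.universal (λ { ((i , j) , (k , l)) →
        beyond r i (2 + j) ∷ beyond r k (2 + l) ∷ [] }) (zigzag (not s) k))
    where
    r : ℕ
    r = outer (not s)

zigzag-far : ∀ s k → AllPairs FarEdges (zigzag s k)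
zigzag-far s zero    = [] ∷ []
zigzag-far s (suc k) = block s (zigzag-clear (not s) k) (AllPairs.map⁺ (AllPairs.map unshift (zigzag-far (not s) k)))
  where
  unshift : ∀ {e f} → FarEdges e f → FarEdges (shiftEdge e) (shiftEdge f)
  -- Adding 4 to both columns leaves their difference unchanged by computation, so the same proofs
  -- serve.
  unshift ((h₁ ∷ h₂ ∷ []) ∷ (h₃ ∷ h₄ ∷ []) ∷ []) = (h₁ ∷ h₂ ∷ []) ∷ (h₃ ∷ h₄ ∷ []) ∷ []

  -- A shifted clear vertex lies in column 5 or later, so its column distance from `q ≤ 3` already
  -- suffices. The split on `q` lets that distance compute.
  before : ∀ r p q → q ≤ 3 → ∀ y → Clear r y → Far (p , q) (shift y)
  before r p 0 _ (i , suc j) _ = ≤-trans 2≤ (m≤n+m (5 + j) ∣ p - i ∣)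
  before r p 1 _ (i , suc j) _ = ≤-trans 2≤ (m≤n+m (4 + j) ∣ p - i ∣)
  before r p 2 _ (i , suc j) _ = ≤-trans 2≤ (m≤n+m (3 + j) ∣ p - i ∣)
  before r p 3 _ (i , suc j) _ = ≤-trans 2≤ (m≤n+m (2 + j) ∣ p - i ∣)
  before r p (suc (suc (suc (suc _)))) (s≤s (s≤s (s≤s ()))) _ _

  tail-far : ∀ r {es} a b → (∀ y → Clear r y → Far a (shift y)) → (∀ y → Clear r y → Far b (shift y)) →
    All (ClearEdge r) es → All (FarEdges (a , b)) (map shiftEdge es)
  tail-far r a b fa fb = All.map⁺ ∘ All.map λ { {x , y} (cx ∷ cy ∷ []) →
    (fa x cx ∷ fa y cy ∷ []) ∷ (fb x cx ∷ fb y cy ∷ []) ∷ [] }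

  1≤3 : 1 ≤ 3
  1≤3 = s≤s z≤n

  2≤3 : 2 ≤ 3
  2≤3 = 2≤

  block : ∀ s {es} → All (ClearEdge (outer (not (not s)))) es → AllPairs FarEdges (map shiftEdge es) →
    AllPairs FarEdges (((outer s , 1) , (2 , 1)) ∷ ((outer (not s) , 2) , (outer (not s) , 3)) ∷
      ((outer s , 3) , (outer s , 4)) ∷ map shiftEdge es)
  block true c far =
    (((2≤ ∷ 2≤ ∷ []) ∷ (2≤ ∷ 2≤ ∷ []) ∷ []) ∷ ((2≤ ∷ 2≤ ∷ []) ∷ (2≤ ∷ 2≤ ∷ []) ∷ [])
      ∷ tail-far 1 (1 , 1) (2 , 1) (before 1 1 1 1≤3) (before 1 2 1 1≤3) c)
    ∷ (((2≤ ∷ 2≤ ∷ []) ∷ (2≤ ∷ 2≤ ∷ []) ∷ [])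
      ∷ tail-far 1 (3 , 2) (3 , 3) (before 1 3 2 2≤3) (before 1 3 3 ≤-refl) c)
    -- `(1 , 4)` is the shift of `(1 , 0)`, so its distance from the tail is literally the second
    -- component of `Clear 1`.
    ∷ tail-far 1 (1 , 3) (1 , 4) (before 1 1 3 ≤-refl) (λ _ → proj₂) c
    ∷ far
  block false c far =
    (((2≤ ∷ 2≤ ∷ []) ∷ (2≤ ∷ 2≤ ∷ []) ∷ []) ∷ ((2≤ ∷ 2≤ ∷ []) ∷ (2≤ ∷ 2≤ ∷ []) ∷ [])
      ∷ tail-far 3 (3 , 1) (2 , 1) (before 3 3 1 1≤3) (before 3 2 1 1≤3) c)
    ∷ (((2≤ ∷ 2≤ ∷ []) ∷ (2≤ ∷ 2≤ ∷ []) ∷ [])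
      ∷ tail-far 3 (1 , 2) (1 , 3) (before 3 1 2 2≤3) (before 3 1 3 ≤-refl) c)
    ∷ tail-far 3 (3 , 3) (3 , 4) (before 3 3 3 ≤-refl) (λ _ → proj₂) c
    ∷ far

shift-adj : ∀ {n m x y} → Adj n m x y → Adj n (4 + m) (shift x) (shift y)
shift-adj (gx , gy , near) = shift-grid gx , shift-grid gy , shift-near near
  where
  shift-grid : ∀ {n m v} → InGrid n m v → InGrid n (4 + m) (shift v)
  shift-grid (i-ok , (1≤j , j≤m)) = i-ok , (s≤s z≤n , +-monoʳ-≤ 4 j≤m)

  shift-near : ∀ {i j k l : ℕ} → (i ≡ k × (l ≡ suc j ⊎ j ≡ suc l)) ⊎ (j ≡ l × (k ≡ suc i ⊎ i ≡ suc k)) →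
    (i ≡ k × (4 + l ≡ suc (4 + j) ⊎ 4 + j ≡ suc (4 + l))) ⊎ (4 + j ≡ 4 + l × (k ≡ suc i ⊎ i ≡ suc k))
  shift-near (inj₁ (refl , inj₁ refl)) = inj₁ (refl , inj₁ refl)
  shift-near (inj₁ (refl , inj₂ refl)) = inj₁ (refl , inj₂ refl)
  shift-near (inj₂ (refl , h))         = inj₂ (refl , h)

-- With the width written `1 + k * 4`, a successor of `k` unfolds to four more columns, as
-- `shift-adj` produces.
zigzag-adj : ∀ s k → All (λ e → Adj 3 (1 + k * 4) (proj₁ e) (proj₂ e)) (zigzag s k)
zigzag-adj = all
  where
  rows : ∀ s → 1 ≤ outer s × outer s ≤ 3
  rows true  = s≤s z≤n , s≤s z≤n
  rows false = s≤s z≤n , ≤-refl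

  meets : ∀ s → 2 ≡ suc (outer s) ⊎ outer s ≡ 3
  meets true  = inj₁ refl
  meets false = inj₂ refl

  first : ∀ s m → Adj 3 (1 + m) (outer s , 1) (2 , 1)
  first s m = (rows s , 1≤1+m) , ((s≤s z≤n , 2≤) , 1≤1+m) , inj₂ (refl , meets s)
    where
    1≤1+m : 1 ≤ 1 × 1 ≤ 1 + m
    1≤1+m = s≤s z≤n , s≤s z≤n

  horizontal : ∀ s {m} j → 2 + j ≤ m → Adj 3 m (outer s , suc j) (outer s , 2 + j)
  horizontal s j h = (rows s , s≤s z≤n , <⇒≤ h) , (rows s , s≤s z≤n , h) , inj₁ (refl , inj₁ refl)

  all : ∀ s k → All (λ e → Adj 3 (1 + k * 4) (proj₁ e) (proj₂ e)) (zigzag s k)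
  all s zero    = first s 0 ∷ []
  all s (suc k) = first s (4 + k * 4)
    ∷ horizontal (not s) 1 (s≤s (s≤s (s≤s z≤n)))
    ∷ horizontal s 2 (s≤s (s≤s (s≤s (s≤s z≤n))))
    ∷ All.map⁺ (All.map shift-adj (all (not s) k))

zigzag-induced : ∀ s k → IsInducedMatching 3 (1 + k * 4) (zigzag s k)
zigzag-induced s k = (λ _ → All.lookup (zigzag-adj s k))
  , AllPairs-lookup Separated-sym (AllPairs.map FarEdges⇒Separated (zigzag-far s k))

-- The nine-column window in a maximum induced matching.

edge-saturates : ∀ {M} a b → EdgeIn a b M → Saturated M a × Saturated M b
edge-saturates a b (inj₁ e∈M) = Any.map (λ { refl → inj₁ refl }) e∈M , Any.map (λ { refl → inj₂ refl }) e∈M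
edge-saturates a b (inj₂ e∈M) = Any.map (λ { refl → inj₂ refl }) e∈M , Any.map (λ { refl → inj₁ refl }) e∈M

edge-vertical : ∀ {M t} → EdgeIn (1 , t) (2 , t) M → bit M 1 t ≡ true × bit M 2 t ≡ true
edge-vertical {M} {t} e = dec-true (saturated? M (1 , t)) (proj₁ (edge-saturates _ _ e))
                        , dec-true (saturated? M (2 , t)) (proj₂ (edge-saturates _ _ e))

-- With `m = 1 + 4k`, the number `3 * m + 1` is four times the `1 + 3k` edges of the zigzag, hence
-- at most `4 * length M`.
maximum-size : ∀ {m M} → m % 4 ≡ 1 → IsMaximumInducedMatching 3 m M → 3 * m + 1 ≤ 2 * ∑ (size ∘ column M) 1 m
maximum-size {m} {M} m%4≡1 (im , maximum) = begin
  3 * m + 1                           ≡⟨ cong (λ m → 3 * m + 1) m≡1+k*4 ⟩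
  3 * (1 + k * 4) + 1                 ≡⟨ arith k ⟩
  2 * (2 * (1 + 3 * k))               ≡⟨ cong (λ l → 2 * (2 * l)) (length-zigzag true k) ⟨
  2 * (2 * length (zigzag true k))    ≤⟨ *-monoʳ-≤ 2 (*-monoʳ-≤ 2 (maximum (zigzag true k)
                                          (subst (λ m → IsInducedMatching 3 m (zigzag true k)) (sym m≡1+k*4) (zigzag-induced true k)))) ⟩
  2 * (2 * length M)                  ≤⟨ *-monoʳ-≤ 2 (2*length≤size im) ⟩
  2 * ∑ (size ∘ column M) 1 m         ∎
  where
  open ≤-Reasoning
  k : ℕ
  k = m / 4
  m≡1+k*4 : m ≡ 1 + k * 4
  m≡1+k*4 = trans (m≡m%n+[m/n]*n m 4) (cong (_+ k * 4) m%4≡1)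
  arith : ∀ k → 3 * (1 + k * 4) + 1 ≡ 2 * (2 * (1 + 3 * k))
  arith = solve-∀

∑-interior : ∀ f a → f (1 + a) ≡ 1 → f (9 + a) ≡ 1 → ∑ f (1 + a) 9 ≡ 2 + ∑ f (2 + a) 7
∑-interior f a f₁ f₉ = begin
  f (1 + a) + ∑ f (2 + a) 8                     ≡⟨ cong₂ _+_ f₁ (∑-+ f (2 + a) 7 1) ⟩
  1 + (∑ f (2 + a) 7 + (f (9 + a) + 0))         ≡⟨ cong (λ x → 1 + (∑ f (2 + a) 7 + (x + 0))) f₉ ⟩
  1 + (∑ f (2 + a) 7 + 1)                       ≡⟨ cong suc (+-comm (∑ f (2 + a) 7) 1) ⟩
  2 + ∑ f (2 + a) 7                             ∎
  where open ≡-Reasoning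

window-counts : ∀ {m M} a r → IsInducedMatching 3 m M →
  3 * (a + (9 + r)) + 1 ≤ 2 * ∑ (size ∘ column M) 1 (a + (9 + r)) →
  EdgeIn (1 , 1 + a) (2 , 1 + a) M → EdgeIn (1 , 9 + a) (2 , 9 + a) M →
  4 ≤ ∑ (wt ∘ bit M 1) (2 + a) 7 × ∑ (wt ∘ bit M 2) (2 + a) 7 ≤ 1 × ∑ (wt ∘ bit M 3) (1 + a) 9 ≤ 5
window-counts {M = M} a r im large e₁ e₉ =
    +-cancelˡ-≤ 2 _ _ (subst (6 ≤_) (∑-interior (wt ∘ bit M 1) a (cong wt (proj₁ s₁)) (cong wt (proj₁ s₉))) (proj₁ rows))
  , +-cancelˡ-≤ 2 _ _ (subst (_≤ 3) (∑-interior (wt ∘ bit M 2) a (cong wt (proj₂ s₁)) (cong wt (proj₂ s₉))) (proj₁ (proj₂ rows)))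
  , proj₂ (proj₂ rows)
  where
  open Walk (column M) (column-ok im)

  s₁ : bit M 1 (1 + a) ≡ true × bit M 2 (1 + a) ≡ true
  s₁ = edge-vertical e₁

  s₉ : bit M 1 (9 + a) ≡ true × bit M 2 (9 + a) ≡ true
  s₉ = edge-vertical e₉

  vertical-column : ∀ t → bit M 1 t ≡ true × bit M 2 t ≡ true → T (vertical (column M t))
  vertical-column t (top≡ , mid≡) = merge _ _ (Equivalence.from T-≡ top≡) (Equivalence.from T-≡ mid≡)

  rows : 6 ≤ ∑ (wt ∘ bit M 1) (1 + a) 9 × ∑ (wt ∘ bit M 2) (1 + a) 9 ≤ 3 × ∑ (wt ∘ bit M 3) (1 + a) 9 ≤ 5
  rows = window-rows a (vertical-column (1 + a) s₁) (vertical-column (9 + a) s₉)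
    (window-size a r large (vertical-column (1 + a) s₁) (vertical-column (9 + a) s₉))

theorem3p8 : (m : ℕ) → m % 4 ≡ 1 →
    (M : List Edge) → IsMaximumInducedMatching 3 m M →
    (j : ℕ) → 1 ≤ j → j + 8 ≤ m →
    EdgeIn (1 , j) (2 , j) M → EdgeIn (1 , j + 8) (2 , j + 8) M →
    (4 ≤ countSaturated M (rowSegment 1 (j + 1) 7))
    × (countSaturated M (rowSegment 2 (j + 1) 7) ≤ 1)
    × (countSaturated M (rowSegment 3 j 9) ≤ 5)
theorem3p8 m m%4≡1 M max@(im , _) (suc a) _ j+8≤m e₁ e₉ =
    subst (4 ≤_) (sym (interior-count 1)) (proj₁ counts)
  , subst (_≤ 1) (sym (interior-count 2)) (proj₁ (proj₂ counts))
  , subst (_≤ 5) (sym (countSaturated-rowSegment M 3 (1 + a) 9)) (proj₂ (proj₂ counts))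
  where
  interior-count : ∀ i → countSaturated M (rowSegment i (suc a + 1) 7) ≡ ∑ (wt ∘ bit M i) (2 + a) 7
  interior-count i = trans (cong (λ s → countSaturated M (rowSegment i s 7)) (+-comm (suc a) 1))
    (countSaturated-rowSegment M i (2 + a) 7)

  -- With `j = suc a`, there are `a` columns to the left of the window and `r` to its right.
  r : ℕ
  r = m ∸ (suc a + 8)

  regroup : ∀ a r → suc a + 8 + r ≡ a + (9 + r)
  regroup = solve-∀

  m≡a+9+r : m ≡ a + (9 + r)
  m≡a+9+r = trans (sym (m+[n∸m]≡n j+8≤m)) (regroup a r)

  counts : 4 ≤ ∑ (wt ∘ bit M 1) (2 + a) 7 × ∑ (wt ∘ bit M 2) (2 + a) 7 ≤ 1 × ∑ (wt ∘ bit M 3) (1 + a) 9 ≤ 5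
  counts = window-counts a r im
    (subst (λ l → 3 * l + 1 ≤ 2 * ∑ (size ∘ column M) 1 l) m≡a+9+r (maximum-size m%4≡1 max))
    e₁ (subst (λ t → EdgeIn (1 , t) (2 , t) M) (+-comm (suc a) 8) e₉)
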